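{- (1) For every expression $e$, the map $\rho\mapsto \llbracket e\rrbracket_r(\rho)$ is a measurable function from $\Sigma_r$ to $\mathbb{R}_e$. (2) If $\mathcal{V}$ is finite or $\mathbf{proj}:\mathbb{R}_e\to\mathbb{F}_e$ is measurable, then for every expression $e$, the map $\rho\mapsto\llbracket e\rrbracket_f(\rho)$ is a measurable function from $\Sigma_f$ to $\mathbb{F}_e$.
   Context: $\mathcal{V}$ is a countable set of variables. Expressions are given by the grammar $e ::= a \mid x \mid \dot{ - }e \mid e\,\dot{+}\,e \mid e\,\dot{ - }\,e\mid e\,\dot{\times}\, e\mid e\,\dot{/}\,e$ with $a\in\mathbb{Q}$, $x\in\mathcal{V}$. Values. $\mathbb{F}\subset\mathbb{R}$ is the finite set of (finite) floating-point numbers, with smallest element $F_{\min}$ and largest element $F_{\max}$. Let $\mathbb{R}_e=\mathbb{R}\cup\{\mathbf{err}\}$, $\mathbb{F}_e=\mathbb{F}\cup\{\mathbf{err}\}$, where $\mathbf{err}$ is an extra symbol. Arithmetic is extended to $\mathbb{R}_e$ by: for $r\in\mathbb{R}_e$ and $\diamond\in\{+,-,\times,/\}$, $\mathbf{err}\diamond r=r\diamond\mathbf{err}=r/0=-\mathbf{err}=\mathbf{err}$. $\mathbf{inj}:\mathbb{F}_e\to\mathbb{R}_e$ is the canonical inclusion (with $\mathbf{inj}(\mathbf{err})=\mathbf{err}$). $\mathbf{proj}:\mathbb{R}_e\to\mathbb{F}_e$ is a fixed map with $\mathbf{proj}(r)=\mathbf{err}$ if $r\notin[F_{\min},F_{\max}]$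 (in particular if $r=\mathbf{err}$), and $\mathbf{proj}(\mathbf{inj}(f))=f$ for all $f\in\mathbb{F}_e$. Environments. $\Sigma_r$ is the set of maps $\mathcal{V}\to\mathbb{R}_e$, $\Sigma_f$ the set of maps $\mathcal{V}\to\mathbb{F}_e$. Real semantics: $\llbracket a\rrbracket_r(\rho)=a$, $\llbracket x\rrbracket_r(\rho)=\rho(x)$, $\llbracket \dot{ - }e\rrbracket_r(\rho)=-\llbracket e\rrbracket_r(\rho)$, and $\llbracket e_1\dot{\diamond}e_2\rrbracket_r(\rho)=\llbracket e_1\rrbracket_r(\rho)\diamond\llbracket e_2\rrbracket_r(\rho)$ for $\diamond\in\{+,-,\times,/\}$. Floating-point semantics: $\llbracket a\rrbracket_f(\rho)=\mathbf{proj}(a)$, $\llbracket x\rrbracket_f(\rho)=\rho(x)$, $\llbracket \dot{ - }e\rrbracket_f(\rho)=\mathbf{proj}(-\mathbf{inj}(\llbracket e\rrbracket_f(\rho)))$, and $\llbracket e_1\dot{\diamond}e_2\rrbracket_f(\rho)=\mathbf{proj}(\mathbf{inj}(\llbracket e_1\rrbracket_f(\rho))\diamond\mathbf{inj}(\llbracket e_2\rrbracket_f(\rho)))$. Topology and measurability. $\mathbb{R}_e$ has the topology whose opens are the open subsets of $\mathbb{R}$, the singleton $\{\mathbf{err}\}$, and their unions (so $\mathbf{err}$ is an isolated point). $\mathbb{F}_e$ has the discrete topology. $\Sigma_r\cong\mathbb{R}_e^{\mathcal{V}}$ and $\Sigma_f\cong\mathbb{F}_e^{\mathcal{V}}$ have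 the product topology. All spaces carry their Borel $\sigma$-algebras, and measurability is with respect to these. -}

module Defs where

open import Algebra.Bundles using (CommutativeRing)
open import Algebra.Structures using (IsCommutativeRing)
open import Data.Fin.Base using (Fin)
open import Data.Integer.Base using (ℤ; +_; -[1+_])
open import Data.Maybe.Base using (Maybe; just; nothing; map)
open import Data.Maybe.Relation.Binary.Pointwise using (Pointwise)
open import Data.Maybe.Relation.Unary.Any using (Any; just)
open import Data.Nat.Base using (ℕ; zero; suc)
open import Data.Product.Base using (∃; ∃₂; ∃-syntax; _×_; _,_; proj₁; proj₂)
open import Data.Rational.Base using (ℚ; ↥_)
open import Data.Sum.Base using (_⊎_; inj₁; inj₂)
open import Data.Unit.Base using (⊤; tt)
open import Data.Unit.Polymorphic.Base using () renaming (⊤ to ⊤ₚ)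
open import Function.Base using (_$_)
open import Function.Bundles using (_↔_)
open import Function.Definitions using (Congruent; Injective)
open import Level using (0ℓ)
open import Relation.Binary.Bundles using (DecTotalOrder)
open import Relation.Binary.Core using (Rel)
open import Relation.Binary.PropositionalEquality.Core using (_≡_; refl)
open import Relation.Binary.Structures using (IsDecTotalOrder)
open import Relation.Nullary.Decidable.Core using (yes; no)
open import Relation.Nullary.Negation.Core using (¬_)
open import Relation.Unary using (Pred; _∈_; _⊆_; _≐_; _∩_; ∁; ⋃; _⊢_; U; Satisfiable)

import Algebra.Definitions.RawMonoid as RawMonoid
import Algebra.Properties.Ring as RingProperties
import Relation.Binary.Properties.DecTotalOrder as DecTotalOrderProperties

Subset : Set → Set₁
Subset X = Pred X 0ℓ

Finite : Set → Set
Finite X = ∃[ n ] (X ↔ Fin n)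

-- ℝ is given axiomatically, as a Dedekind-complete ordered field; these
-- axioms determine it up to isomorphism.  Equality is a setoid equality,
-- so that cuts or Cauchy sequences of rationals are models.  The order is
-- decidable, as it is classically: case distinctions such as "r = 0" in
-- the definition of division need this.
record RealNumbers : Set₁ where
  infix  8 -_
  infixl 7 _*_
  infixl 6 _+_
  infix  4 _≈_ _≤_

  field
    Carrier : Set
    _≈_ _≤_ : Rel Carrier 0ℓ
    _+_ _*_ : Carrier → Carrier → Carrier
    -_      : Carrier → Carrier
    0# 1#   : Carrier

    isCommutativeRing : IsCommutativeRing _≈_ _+_ _*_ -_ 0# 1#
    0≉1               : ¬ (0# ≈ 1#)
    inverse           : ∀ x → ¬ (x ≈ 0#) → ∃[ y ] (x * y ≈ 1#)

    isDecTotalOrder   : IsDecTotalOrder _≈_ _≤_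
    +-monoʳ-≤         : ∀ x {y z} → y ≤ z → x + y ≤ x + z
    *-nonNeg          : ∀ {x y} → 0# ≤ x → 0# ≤ y → 0# ≤ x * y

  UpperBound : Subset Carrier → Carrier → Set
  UpperBound S b = ∀ {x} → x ∈ S → x ≤ b

  field
    supremum : (S : Subset Carrier) → Satisfiable S → ∃ (UpperBound S) →
               ∃[ s ] (UpperBound S s × (∀ b → UpperBound S b → s ≤ b))

  commutativeRing : CommutativeRing 0ℓ 0ℓ
  commutativeRing = record { isCommutativeRing = isCommutativeRing }

  decTotalOrder : DecTotalOrder 0ℓ 0ℓ 0ℓ
  decTotalOrder = record { isDecTotalOrder = isDecTotalOrder }

  open DecTotalOrder decTotalOrder public
    using (_≟_; total; antisym; ≤-respˡ-≈; ≤-respʳ-≈)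
    renaming (refl to ≤-refl; trans to ≤-trans)
  -- x < y is x ≤ y × ¬ (x ≈ y)
  open DecTotalOrderProperties decTotalOrder public using (_<_)

  private
    module R = CommutativeRing commutativeRing
  open RawMonoid R.+-rawMonoid using () renaming (_×_ to _·_)

  0≤1 : 0# ≤ 1#
  0≤1 with total 0# 1#
  ... | inj₁ 0≤1 = 0≤1
  ... | inj₂ 1≤0 = ≤-respʳ-≈ [-1][-1]≈1 (*-nonNeg 0≤-1 0≤-1)
    where
    open RingProperties R.ring using (-1*x≈-x; -‿involutive)
    0≤-1 : 0# ≤ - 1#
    0≤-1 = ≤-respˡ-≈ (R.-‿inverseˡ 1#)
             (≤-respʳ-≈ (R.+-identityʳ (- 1#)) (+-monoʳ-≤ (- 1#) 1≤0))
    [-1][-1]≈1 : - 1# * - 1# ≈ 1#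
    [-1][-1]≈1 = R.trans (-1*x≈-x (- 1#)) (-‿involutive 1#)

  private
    0≤n·1 : ∀ n → 0# ≤ n · 1#
    1≤[1+n]·1 : ∀ n → 1# ≤ suc n · 1#
    0≤n·1 zero    = ≤-refl
    0≤n·1 (suc n) = ≤-trans 0≤1 (1≤[1+n]·1 n)
    1≤[1+n]·1 n = ≤-respˡ-≈ (R.+-identityʳ 1#) (+-monoʳ-≤ 1# (0≤n·1 n))

  [1+n]·1≉0 : ∀ n → ¬ (suc n · 1# ≈ 0#)
  [1+n]·1≉0 n eq = 0≉1 (antisym 0≤1 (≤-respʳ-≈ eq (1≤[1+n]·1 n)))

  fromℤ : ℤ → Carrier
  fromℤ (+ n)    = n · 1#
  fromℤ -[1+ n ] = - (suc n · 1#)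

  fromℚ : ℚ → Carrier
  fromℚ q = fromℤ (↥ q) * proj₁ (inverse (suc d · 1#) ([1+n]·1≉0 d))
    where d = ℚ.denominator-1 q

record TopologicalSpace : Set₂ where
  field
    Carrier : Set
    Open    : Subset Carrier → Set₁
    resp-≐  : ∀ {A B} → A ≐ B → Open A → Open B
    U-open  : Open U
    ∩-open  : ∀ {A B} → Open A → Open B → Open (A ∩ B)
    ⋃-open  : {I : Set} (A : I → Subset Carrier) →
              (∀ i → Open (A i)) → Open (⋃ I A)

module _ {X : Set} (𝒢 : Subset X → Set₁) where

  data GeneratedTopology : Subset X → Set₁ where
    gen    : ∀ {A} → 𝒢 A → GeneratedTopology A
    resp-≐ : ∀ {A B} → A ≐ B → GeneratedTopology A → GeneratedTopology B
    U-open : GeneratedTopology U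
    ∩-open : ∀ {A B} → GeneratedTopology A → GeneratedTopology B →
             GeneratedTopology (A ∩ B)
    ⋃-open : {I : Set} (A : I → Subset X) →
             (∀ i → GeneratedTopology (A i)) → GeneratedTopology (⋃ I A)

  data GeneratedσAlgebra : Subset X → Set₁ where
    gen    : ∀ {A} → 𝒢 A → GeneratedσAlgebra A
    resp-≐ : ∀ {A B} → A ≐ B → GeneratedσAlgebra A → GeneratedσAlgebra B
    ∁-mem  : ∀ {A} → GeneratedσAlgebra A → GeneratedσAlgebra (∁ A)
    ⋃-mem  : (A : ℕ → Subset X) →
             (∀ n → GeneratedσAlgebra (A n)) → GeneratedσAlgebra (⋃ ℕ A)

generatedSpace : (X : Set) → (Subset X → Set₁) → TopologicalSpace
generatedSpace X 𝒢 = record { Carrier = X ; Open = GeneratedTopology 𝒢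
  ; resp-≐ = resp-≐ ; U-open = U-open ; ∩-open = ∩-open ; ⋃-open = ⋃-open }

discreteSpace : Set → TopologicalSpace
discreteSpace X = record { Carrier = X ; Open = λ _ → ⊤ₚ
  ; resp-≐ = λ _ _ → _ ; U-open = _ ; ∩-open = λ _ _ → _ ; ⋃-open = λ _ _ → _ }

module _ (X : TopologicalSpace) where
  open TopologicalSpace X

  Borel : Subset Carrier → Set₁
  Borel = GeneratedσAlgebra Open

  module _ (I : Set) where

    data Cylinder : Subset (I → Carrier) → Set₁ where
      cylinder : ∀ i {A} → Open A → Cylinder ((_$ i) ⊢ A)

    powerSpace : TopologicalSpace
    powerSpace = generatedSpace (I → Carrier) Cylinder

Measurable : (X Y : TopologicalSpace) →
             (TopologicalSpace.Carrier X → TopologicalSpace.Carrier Y) → Set₁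
Measurable X Y f = ∀ {B} → Borel Y B → Borel X (f ⊢ B)

data Op : Set where
  plus minus times divide : Op

data Expr (V : Set) : Set where
  const : ℚ → Expr V
  var   : V → Expr V
  neg   : Expr V → Expr V
  bin   : Op → Expr V → Expr V → Expr V

pattern err = nothing

module ExtendedReals (R : RealNumbers) where
  open RealNumbers R

  ℝₑ : Set
  ℝₑ = Maybe Carrier

  _≈ₑ_ : Rel ℝₑ 0ℓ
  _≈ₑ_ = Pointwise _≈_

  negₑ : ℝₑ → ℝₑ
  negₑ = map -_

  quotient : Carrier → Carrier → ℝₑ
  quotient r s with s ≟ 0#
  ... | yes _  = err
  ... | no s≉0 = just (r * proj₁ (inverse s s≉0))

  opₑ : Op → ℝₑ → ℝₑ → ℝₑ
  opₑ _      err      _        = err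
  opₑ _      (just _) err      = err
  opₑ plus   (just r) (just s) = just (r + s)
  opₑ minus  (just r) (just s) = just (r + - s)
  opₑ times  (just r) (just s) = just (r * s)
  opₑ divide (just r) (just s) = quotient r s

  Openℝ : Subset Carrier → Set
  Openℝ A = ∀ {x} → x ∈ A →
    ∃₂ λ a b → (a < x × x < b) × (∀ {y} → a < y → y < b → y ∈ A)

  ｛err｝ : Subset ℝₑ
  ｛err｝ r = r ≡ err

  -- Any A is the image of A under the inclusion of ℝ in ℝₑ.
  data Openₑ : Subset ℝₑ → Set₁ where
    open-real : ∀ {A} → Openℝ A → Openₑ (Any A)
    open-err  : Openₑ ｛err｝
    ⋃-openₑ   : {I : Set} (A : I → Subset ℝₑ) →
                (∀ i → Openₑ (A i)) → Openₑ (⋃ I A)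
    resp-≐ₑ   : ∀ {A B} → A ≐ B → Openₑ A → Openₑ B

  private
    import Relation.Binary.Construct.NonStrictToStrict _≈_ _≤_ as Strict
    module O = DecTotalOrder decTotalOrder

    ≤-<-trans : ∀ {x y z} → x ≤ y → y < z → x < z
    ≤-<-trans = Strict.≤-<-trans ≤-trans antisym ≤-respˡ-≈

    <-≤-trans : ∀ {x y z} → x < y → y ≤ z → x < z
    <-≤-trans = Strict.<-≤-trans O.Eq.sym ≤-trans antisym ≤-respʳ-≈

    below : ∀ {x a b} → a < x → b < x → ∃[ c ] (c < x × a ≤ c × b ≤ c)
    below {a = a} {b} a<x b<x with total a b
    ... | inj₁ a≤b = b , b<x , a≤b , ≤-refl
    ... | inj₂ b≤a = a , a<x , ≤-refl , b≤a

    above : ∀ {x a b} → x < a → x < b → ∃[ c ] (x < c × c ≤ a × c ≤ b)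
    above {a = a} {b} x<a x<b with total a b
    ... | inj₁ a≤b = a , x<a , ≤-refl , a≤b
    ... | inj₂ b≤a = b , x<b , b≤a , ≤-refl

    ∩-openℝ : ∀ {A B} → Openℝ A → Openℝ B → Openℝ (A ∩ B)
    ∩-openℝ oA oB (x∈A , x∈B)
      with _ , _ , (a<x , x<b) , ab⊆A ← oA x∈A
         | _ , _ , (c<x , x<d) , cd⊆B ← oB x∈B
      with l , l<x , a≤l , c≤l ← below a<x c<x
         | u , x<u , u≤b , u≤d ← above x<b x<d
      = l , u , (l<x , x<u) , λ l<y y<u →
          ab⊆A (≤-<-trans a≤l l<y) (<-≤-trans y<u u≤b) ,
          cd⊆B (≤-<-trans c≤l l<y) (<-≤-trans y<u u≤d)

    trace : ∀ {A} → Openₑ A → Openℝ (just ⊢ A)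
    trace (open-real oA) (just x∈A) with oA x∈A
    ... | a , b , a<x<b , ab⊆A = a , b , a<x<b , λ a<y y<b → just (ab⊆A a<y y<b)
    trace open-err ()
    trace (⋃-openₑ A oA) (i , x∈Aᵢ) with trace (oA i) x∈Aᵢ
    ... | a , b , a<x<b , ab⊆A = a , b , a<x<b , λ a<y y<b → i , ab⊆A a<y y<b
    trace (resp-≐ₑ (A⊆B , B⊆A) oA) x∈B with trace oA (B⊆A x∈B)
    ... | a , b , a<x<b , ab⊆A = a , b , a<x<b , λ a<y y<b → A⊆B (ab⊆A a<y y<b)

    fromTrace : ∀ {A} → Openℝ (just ⊢ A) → Openₑ A
    fromTrace {A} oA = resp-≐ₑ (to , from) (⋃-openₑ piece piece-open)
      where
      piece : ⊤ ⊎ A err → Subset ℝₑ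
      piece (inj₁ _) = Any (just ⊢ A)
      piece (inj₂ _) = ｛err｝
      piece-open : ∀ i → Openₑ (piece i)
      piece-open (inj₁ _) = open-real oA
      piece-open (inj₂ _) = open-err
      to : ⋃ _ piece ⊆ A
      to (inj₁ _ , just r∈A) = r∈A
      to (inj₂ e∈A , refl)   = e∈A
      from : A ⊆ ⋃ _ piece
      from {just _} r∈A = inj₁ tt , just r∈A
      from {err}    e∈A = inj₂ e∈A , refl

  ℝₑ-space : TopologicalSpace
  ℝₑ-space = record
    { Carrier = ℝₑ
    ; Open    = Openₑ
    ; resp-≐  = resp-≐ₑ
    ; U-open  = fromTrace λ {x} _ →
        x + - 1# , x + 1# , (x-1<x x , x<x+1 x) , λ _ _ → _
    ; ∩-open  = λ oA oB → fromTrace (∩-openℝ (trace oA) (trace oB))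
    ; ⋃-open  = ⋃-openₑ
    }
    where
    module R = CommutativeRing commutativeRing
    open RingProperties R.ring using (+-cancelˡ)
    x<x+1 : ∀ x → x < x + 1#
    x<x+1 x = ≤-respˡ-≈ (R.+-identityʳ x) (+-monoʳ-≤ x 0≤1) ,
      λ x≈x+1 → 0≉1 (+-cancelˡ x 0# 1# (R.trans (R.+-identityʳ x) x≈x+1))
    x-1<x : ∀ x → x + - 1# < x
    x-1<x x with x<x+1 (x + - 1#)
    ... | le , ne = ≤-respʳ-≈ x-1+1≈x le , λ eq → ne (R.trans eq (R.sym x-1+1≈x))
      where
      x-1+1≈x : x + - 1# + 1# ≈ x
      x-1+1≈x = R.trans (R.+-assoc x (- 1#) 1#)
                  (R.trans (R.+-congˡ (R.-‿inverseˡ 1#)) (R.+-identityʳ x))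

open ExtendedReals using (ℝₑ; _≈ₑ_; opₑ; negₑ; ℝₑ-space) public

record FloatingPoint (R : RealNumbers) : Set where
  open RealNumbers R
  field
    -- 𝔽 = {value 0, …, value (size - 1)}, without repetition.
    size            : ℕ
    value           : Fin size → Carrier
    value-injective : Injective _≡_ _≈_ value

    Fmin Fmax : Fin size
    Fmin-least    : ∀ f → value Fmin ≤ value f
    Fmax-greatest : ∀ f → value f ≤ value Fmax

  𝔽ₑ : Set
  𝔽ₑ = Maybe (Fin size)

  inj : 𝔽ₑ → ℝₑ R
  inj = map value

  InRange : ℝₑ R → Set
  InRange = Any (λ r → value Fmin ≤ r × r ≤ value Fmax)

  field
    proj            : ℝₑ R → 𝔽ₑ
    proj-cong       : Congruent (_≈ₑ_ R) _≡_ proj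
    proj-outOfRange : ∀ r → ¬ InRange r → proj r ≡ err
    proj-inj        : ∀ f → proj (inj f) ≡ f

  𝔽ₑ-space : TopologicalSpace
  𝔽ₑ-space = discreteSpace 𝔽ₑ

open FloatingPoint using (𝔽ₑ-space) public

module _ (R : RealNumbers) {V : Set} where
  open RealNumbers R using (fromℚ)

  ⟦_⟧ᵣ : Expr V → (V → ℝₑ R) → ℝₑ R
  ⟦ const a ⟧ᵣ     ρ = just (fromℚ a)
  ⟦ var x ⟧ᵣ       ρ = ρ x
  ⟦ neg e ⟧ᵣ       ρ = negₑ R (⟦ e ⟧ᵣ ρ)
  ⟦ bin ⋄ e₁ e₂ ⟧ᵣ ρ = opₑ R ⋄ (⟦ e₁ ⟧ᵣ ρ) (⟦ e₂ ⟧ᵣ ρ)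

module _ {R : RealNumbers} (F : FloatingPoint R) {V : Set} where
  open RealNumbers R using (fromℚ)
  open FloatingPoint F

  ⟦_⟧f : Expr V → (V → 𝔽ₑ) → 𝔽ₑ
  ⟦ const a ⟧f     ρ = proj (just (fromℚ a))
  ⟦ var x ⟧f       ρ = ρ x
  ⟦ neg e ⟧f       ρ = proj (negₑ R (inj (⟦ e ⟧f ρ)))
  ⟦ bin ⋄ e₁ e₂ ⟧f ρ = proj (opₑ R ⋄ (inj (⟦ e₁ ⟧f ρ)) (inj (⟦ e₂ ⟧f ρ)))

{-# OPTIONS --safe #-}

-- (1) A map f into ℝₑ is measurable as soon as the sets {a < f} are Borel,
-- and these are computed from f and g by countable unions over a dense
-- family of reals, e.g.
--   a < f + g  iff  q < f and a - q < g for some q,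
-- and, where 0 < g,
--   a < f g    iff  q < f and a < q g for some q,
--   a < f / g  iff  0 < f - a g.
-- (2) As 𝔽ₑ is discrete, every subset of 𝔽ₑ × 𝔽ₑ is open, so the
-- floating-point semantics is continuous by induction on the expression.
module Submission where

open import Defs
open import Algebra.Bundles using (CommutativeRing)
open import Axiom.ExcludedMiddle using (ExcludedMiddle)
open import Data.Empty using (⊥-elim)
open import Data.Maybe.Base using (just; nothing; map)
open import Data.Maybe.Relation.Binary.Pointwise using (just; nothing)
open import Data.Maybe.Relation.Unary.Any using (Any; just)
open import Data.Nat.Base using (ℕ; zero; suc)
open import Data.Product.Base using (∃-syntax; Σ-syntax; _×_; _,_; proj₁; proj₂)
open import Data.Sum.Base using (_⊎_; inj₁; inj₂)
open import Function.Base using (_∘_)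
open import Function.Bundles using (_↣_)
open import Level using (0ℓ)
open import Relation.Binary.Definitions using (tri<; tri≈; tri>)
open import Relation.Binary.PropositionalEquality.Core using (_≡_; refl; subst)
  renaming (sym to ≡-sym)
open import Relation.Nullary.Decidable.Core using (yes; no; decidable-stable)
open import Relation.Nullary.Negation.Core using (¬_)
open import Relation.Unary using (_∩_; _∪_; ∁; ⋃; _⊢_; U)

import Algebra.Properties.Ring as RingProperties
import Relation.Binary.Bundles as Bundles
import Relation.Binary.Properties.DecTotalOrder as DecTotalOrderProperties
import Relation.Binary.Reasoning.PartialOrder as PartialOrderReasoning

-- Strict inequalities in an ordered field, and a countable grid of points.

module OrderedField (R : RealNumbers) where
  open RealNumbers R
  open CommutativeRing commutativeRing public
    using ( ring; sym; +-comm; +-assoc; +-congˡ; +-congʳ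
          ; +-identityˡ; +-identityʳ; -‿cong; -‿inverseʳ
          ; *-comm; *-assoc; *-congˡ; *-congʳ; *-identityʳ
          ; distribʳ; zeroˡ; zeroʳ)
    renaming (refl to ≈-refl; trans to ≈-trans)
  open RingProperties ring public
    using ( \\-leftDividesˡ; //-rightDividesˡ; //-rightDividesʳ
          ; -‿involutive; -‿distribˡ-*; -‿distribʳ-*; -0#≈0#)
  open DecTotalOrderProperties decTotalOrder public
    using (<-irrefl; <-asym; <-trans; <-respˡ-≈; <-respʳ-≈; <-compare; ≮⇒≥)
  open PartialOrderReasoning (Bundles.DecTotalOrder.poset decTotalOrder) public

  infixl 8 _·_
  _·_ : ℕ → Carrier → Carrier
  zero  · x = 0#
  suc n · x = x + n · x

  -- The unfolded proofs would swamp the with-abstractions that mention them.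
  abstract
    +-monoʳ-< : ∀ z {x y} → x < y → z + x < z + y
    +-monoʳ-< z {x} {y} (x≤y , x≉y) = +-monoʳ-≤ z x≤y , λ eq →
      x≉y (RingProperties.+-cancelˡ ring z x y eq)

    +-monoˡ-< : ∀ z {x y} → x < y → x + z < y + z
    +-monoˡ-< z {x} {y} x<y =
      <-respˡ-≈ (+-comm z x) (<-respʳ-≈ (+-comm z y) (+-monoʳ-< z x<y))

    x<y+z⇒x-z<y : ∀ {x y z} → x < y + z → x + - z < y
    x<y+z⇒x-z<y {y = y} {z} x<y+z =
      <-respʳ-≈ (//-rightDividesʳ z y) (+-monoˡ-< (- z) x<y+z)

    x-z<y⇒x<y+z : ∀ {x y z} → x + - z < y → x < y + z
    x-z<y⇒x<y+z {x} {z = z} x-z<y =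
      <-respˡ-≈ (//-rightDividesˡ z x) (+-monoˡ-< z x-z<y)

    x+z<y⇒x<y-z : ∀ {x y z} → x + z < y → x < y + - z
    x+z<y⇒x<y-z {x} {z = z} x+z<y =
      <-respˡ-≈ (//-rightDividesʳ z x) (+-monoˡ-< (- z) x+z<y)

    neg-anti-< : ∀ {x y} → x < y → - y < - x
    neg-anti-< {x} {y} x<y = begin-strict
      - y              ≈⟨ \\-leftDividesˡ x (- y) ⟨
      x + (- x + - y)  <⟨ +-monoˡ-< (- x + - y) x<y ⟩
      y + (- x + - y)  ≈⟨ +-congˡ (+-comm (- x) (- y)) ⟩
      y + (- y + - x)  ≈⟨ \\-leftDividesˡ y (- x) ⟩
      - x              ∎

    x<y⇒0<y-x : ∀ {x y} → x < y → 0# < y + - x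
    x<y⇒0<y-x {x} {y} x<y = x+z<y⇒x<y-z (<-respˡ-≈ (sym (+-identityˡ x)) x<y)

    0<y-x⇒x<y : ∀ {x y} → 0# < y + - x → x < y
    0<y-x⇒x<y {x} {y} 0<y-x =
      <-respˡ-≈ (+-identityˡ x) (<-respʳ-≈ (//-rightDividesˡ x y) (+-monoˡ-< x 0<y-x))

    y-x<0⇒y<x : ∀ {x y} → y + - x < 0# → y < x
    y-x<0⇒y<x {x} y-x<0 = <-respʳ-≈ (+-identityˡ x) (x-z<y⇒x<y+z y-x<0)

    y<x⇒y-x<0 : ∀ {x y} → y < x → y + - x < 0#
    y<x⇒y-x<0 {x} y<x = x<y+z⇒x-z<y (<-respʳ-≈ (sym (+-identityˡ x)) y<x)

    0<1 : 0# < 1#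
    0<1 = 0≤1 , 0≉1

    x<x+ε : ∀ x {ε} → 0# < ε → x < x + ε
    x<x+ε x 0<ε = <-respˡ-≈ (+-identityʳ x) (+-monoʳ-< x 0<ε)

    x-1<x : ∀ x → x + - 1# < x
    x-1<x x = x<y+z⇒x-z<y (x<x+ε x 0<1)

    x<0⇒0<-x : ∀ {x} → x < 0# → 0# < - x
    x<0⇒0<-x x<0 = <-respˡ-≈ -0#≈0# (neg-anti-< x<0)

    x*[y*z]≈x : ∀ x {y z} → y * z ≈ 1# → x * y * z ≈ x
    x*[y*z]≈x x {y} {z} yz≈1 =
      ≈-trans (*-assoc x y z) (≈-trans (*-congˡ yz≈1) (*-identityʳ x))

    -x*-y≈x*y : ∀ x y → - x * - y ≈ x * y
    -x*-y≈x*y x y = ≈-trans (sym (-‿distribʳ-* (- x) y))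
      (≈-trans (-‿cong (sym (-‿distribˡ-* x y))) (-‿involutive (x * y)))

    -- The axiom `*-nonNeg` gives the weak inequality. Strictness holds because a field has no zero
    -- divisors: if the product vanished, multiplying by the inverse of `y` would give `x ≈ 0#`.
    *-pos : ∀ {x y} → 0# < x → 0# < y → 0# < x * y
    *-pos {x} {y} (0≤x , 0≉x) (0≤y , 0≉y) = *-nonNeg 0≤x 0≤y , xy≉0
      where
      xy≉0 : ¬ (0# ≈ x * y)
      xy≉0 0≈xy with w , yw≈1 ← inverse y (0≉y ∘ sym) =
        0≉x (≈-trans (sym (zeroˡ w))
          (≈-trans (*-congʳ 0≈xy) (x*[y*z]≈x x yw≈1)))

    *-monoˡ-<-pos : ∀ {x y z} → 0# < z → x < y → x * z < y * z
    *-monoˡ-<-pos {x} {y} {z} 0<z x<y = 0<y-x⇒x<y (begin-strict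
      0#                 <⟨ *-pos (x<y⇒0<y-x x<y) 0<z ⟩
      (y + - x) * z      ≈⟨ distribʳ z y (- x) ⟩
      y * z + - x * z    ≈⟨ +-congˡ (-‿distribˡ-* x z) ⟨
      y * z + - (x * z)  ∎)

    *-monoˡ-<-neg : ∀ {x y z} → z < 0# → x < y → y * z < x * z
    *-monoˡ-<-neg {x} {y} {z} z<0 x<y =
      <-respˡ-≈ (neg-neg y) (<-respʳ-≈ (neg-neg x)
        (neg-anti-< (*-monoˡ-<-pos (x<0⇒0<-x z<0) x<y)))
      where
      neg-neg : ∀ x → - (x * - z) ≈ x * z
      neg-neg x = ≈-trans (-‿cong (sym (-‿distribʳ-* x z))) (-‿involutive (x * z))

    *-cancelʳ-<-pos : ∀ {x y z} → 0# < z → x * z < y * z → x < y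
    *-cancelʳ-<-pos {x} {y} 0<z xz<yz with <-compare x y
    ... | tri< x<y _ _ = x<y
    ... | tri≈ _ x≈y _ = ⊥-elim (<-irrefl (*-congʳ x≈y) xz<yz)
    ... | tri> _ _ y<x = ⊥-elim (<-asym xz<yz (*-monoˡ-<-pos 0<z y<x))

    *-cancelʳ-<-neg : ∀ {x y z} → z < 0# → y * z < x * z → x < y
    *-cancelʳ-<-neg {x} {y} z<0 yz<xz with <-compare x y
    ... | tri< x<y _ _ = x<y
    ... | tri≈ _ x≈y _ = ⊥-elim (<-irrefl (*-congʳ (sym x≈y)) yz<xz)
    ... | tri> _ _ y<x = ⊥-elim (<-asym yz<xz (*-monoˡ-<-neg z<0 y<x))

    leftInverse : ∀ {x} → 0# < x → ∃[ w ] (w * x ≈ 1#)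
    leftInverse {x} (_ , 0≉x) with w , xw≈1 ← inverse x (0≉x ∘ sym) =
      w , ≈-trans (*-comm w x) xw≈1

    leftInverse-pos : ∀ {w x} → 0# < x → w * x ≈ 1# → 0# < w
    leftInverse-pos {w} {x} 0<x wx≈1 =
      *-cancelʳ-<-pos 0<x (<-respˡ-≈ (sym (zeroˡ x)) (<-respʳ-≈ (sym wx≈1) 0<1))

    0≤n·1 : ∀ n → 0# ≤ n · 1#
    0≤n·1 zero    = ≤-refl
    0≤n·1 (suc n) = begin
      0#           ≤⟨ 0≤1 ⟩
      1#           ≈⟨ +-identityʳ 1# ⟨
      1# + 0#      ≤⟨ +-monoʳ-≤ 1# (0≤n·1 n) ⟩
      1# + n · 1#  ∎

    0<[1+n]·1 : ∀ n → 0# < suc n · 1#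
    0<[1+n]·1 n = begin-strict
      0#           ≤⟨ 0≤n·1 n ⟩
      n · 1#       <⟨ x<x+ε (n · 1#) 0<1 ⟩
      n · 1# + 1#  ≈⟨ +-comm (n · 1#) 1# ⟩
      1# + n · 1#  ∎

    stepSize : ℕ → Carrier
    stepSize n = proj₁ (leftInverse (0<[1+n]·1 n))

    stepSize-inverse : ∀ n → stepSize n * (suc n · 1#) ≈ 1#
    stepSize-inverse n = proj₂ (leftInverse (0<[1+n]·1 n))

  -- The point (n , m , k) is (m - k) / (n + 1).
  Index : Set
  Index = ℕ × ℕ × ℕ

  point : Index → Carrier
  point (n , m , k) = m · stepSize n + - (k · stepSize n)

-- The Archimedean property and density of the grid.

module Density (em : ExcludedMiddle 0ℓ) (R : RealNumbers) where
  open RealNumbers R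
  open OrderedField R

  abstract
    -- If `x` bounded all multiples of `δ`, they would have a supremum `s`. Each multiple has a
    -- successor that is also at most `s`, so `s - δ` would be a smaller upper bound.
    archimedean : ∀ {δ} → 0# < δ → ∀ x → ∃[ n ] (x < n · δ)
    archimedean {δ} 0<δ x with em {P = ∃[ n ] (x < n · δ)}
    ... | yes x<nδ = x<nδ
    ... | no  x≮nδ
      with s , ub , least ← supremum (λ y → ∃[ n ] (y ≈ n · δ)) (0# , 0 , ≈-refl)
             (x , λ { (n , y≈nδ) →
               ≤-respˡ-≈ (sym y≈nδ) (≮⇒≥ λ x<nδ → x≮nδ (n , x<nδ)) })
      = ⊥-elim (<-irrefl ≈-refl (begin-strict
          s            ≤⟨ least (s + - δ) s-δ-bound ⟩
          s + - δ      <⟨ x<x+ε (s + - δ) 0<δ ⟩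
          s + - δ + δ  ≈⟨ //-rightDividesˡ δ s ⟩
          s            ∎))
      where
      s-δ-bound : UpperBound (λ y → ∃[ n ] (y ≈ n · δ)) (s + - δ)
      s-δ-bound {y} (n , y≈nδ) = begin
        y                      ≈⟨ y≈nδ ⟩
        n · δ                  ≈⟨ \\-leftDividesˡ (- δ) (n · δ) ⟨
        - δ + (- - δ + n · δ)  ≈⟨ +-congˡ (+-congʳ (-‿involutive δ)) ⟩
        - δ + (δ + n · δ)      ≤⟨ +-monoʳ-≤ (- δ) (ub (suc n , ≈-refl)) ⟩
        - δ + s                ≈⟨ +-comm (- δ) s ⟩
        s + - δ                ∎

    -- Let `w` be the inverse of `ε` and choose `n` above `w`. Then `w < n + 1`, and passing to
    -- reciprocals gives 1/(n + 1) < `ε`.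
    small-stepSize : ∀ {ε} → 0# < ε → ∃[ n ] (0# < stepSize n × stepSize n < ε)
    small-stepSize {ε} 0<ε = n , 0<δ , *-cancelʳ-<-pos 0<w (begin-strict
      δ * w  ≈⟨ *-comm δ w ⟩
      w * δ  <⟨ *-monoˡ-<-pos 0<δ w<N ⟩
      N * δ  ≈⟨ *-comm N δ ⟩
      δ * N  ≈⟨ stepSize-inverse n ⟩
      1#     ≈⟨ wε≈1 ⟨
      w * ε  ≈⟨ *-comm w ε ⟩
      ε * w  ∎)
      where
      w : Carrier
      w = proj₁ (leftInverse 0<ε)
      wε≈1 : w * ε ≈ 1#
      wε≈1 = proj₂ (leftInverse 0<ε)
      n : ℕ
      n = proj₁ (archimedean 0<1 w)
      δ N : Carrier
      δ = stepSize n
      N = suc n · 1#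
      0<w : 0# < w
      0<w = leftInverse-pos 0<ε wε≈1
      w<N : w < N
      w<N = <-trans (proj₂ (archimedean 0<1 w))
              (<-respʳ-≈ (+-comm (n · 1#) 1#) (x<x+ε (n · 1#) 0<1))
      0<δ : 0# < δ
      0<δ = leftInverse-pos (<-trans 0<w w<N) (stepSize-inverse n)

    -- Descend from the upper bound `m · δ` until lowering it once more would no longer leave it
    -- above `x`; since `0# ≤ x`, this happens before zero is reached.
    floor : ∀ {δ x} m → 0# ≤ x → x < m · δ → ∃[ n ] (n · δ ≤ x × x < suc n · δ)
    floor zero 0≤x x<0 = ⊥-elim (<-irrefl ≈-refl (begin-strict
      0#  ≤⟨ 0≤x ⟩
      _   <⟨ x<0 ⟩
      0#  ∎))
    floor {δ} {x} (suc m) 0≤x x<[1+m]δ with em {P = x < m · δ}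
    ... | yes x<mδ = floor m 0≤x x<mδ
    ... | no  x≮mδ = m , ≮⇒≥ x≮mδ , x<[1+m]δ

    0≤x+y : ∀ {x y} → - x < y → 0# ≤ x + y
    0≤x+y {x} {y} -x<y = begin
      0#       ≈⟨ -‿inverseʳ x ⟨
      x + - x  <⟨ +-monoʳ-< x -x<y ⟩
      x + y    ∎

    -- The grid point following one that is at most `x` exceeds `x` by at most `δ`, which is less
    -- than the gap between `x` and `y`.
    multiple-below : ∀ {x y δ} k m → δ < y + - x → m · δ ≤ x + k · δ →
                     suc m · δ + - (k · δ) < y
    multiple-below {x} {y} {δ} k m δ<y-x mδ≤x+kδ = x<y+z⇒x-z<y (begin-strict
      δ + m · δ            ≤⟨ +-monoʳ-≤ δ mδ≤x+kδ ⟩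
      δ + (x + k · δ)      ≈⟨ +-assoc δ x (k · δ) ⟨
      δ + x + k · δ        <⟨ +-monoˡ-< (k · δ) (+-monoˡ-< x δ<y-x) ⟩
      y + - x + x + k · δ  ≈⟨ +-congʳ (//-rightDividesˡ x y) ⟩
      y + k · δ            ∎)

    -- Take a step `δ` shorter than `y - x`, shift `x` by `k` steps so that it becomes nonnegative,
    -- and round down to `m` steps.
    dense : ∀ {x y} → x < y → ∃[ i ] (x < point i × point i < y)
    dense {x} {y} x<y
      with n , 0<δ , δ<y-x ← small-stepSize (x<y⇒0<y-x x<y)
      with k , -x<kδ ← archimedean 0<δ (- x)
      with M , x+kδ<Mδ ← archimedean 0<δ (x + k · stepSize n)
      with m , mδ≤x+kδ , x+kδ<[1+m]δ ← floor M (0≤x+y -x<kδ) x+kδ<Mδ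
      -- Rounding down only gives a weak inequality, so the point strictly above `x` is the next
      -- one, with `suc m`.
      = (n , suc m , k) , x+z<y⇒x<y-z x+kδ<[1+m]δ , multiple-below k m δ<y-x mδ≤x+kδ

-- Closure properties of Borel sets, and measurability tested on open sets.

module BorelSets (em : ExcludedMiddle 0ℓ) (X : TopologicalSpace) where
  open TopologicalSpace X using (Carrier)

  -- By excluded middle the set is everything or empty. This allows side conditions on indices and
  -- constants to be intersected into the members of a countable union.
  Borel-const : (P : Set) → Borel X (λ _ → P)
  Borel-const P with em {P = P}
  ... | yes p = resp-≐ ((λ _ → p) , _) (gen (TopologicalSpace.U-open X))
  ... | no ¬p = resp-≐ ((λ ¬u → ⊥-elim (¬u _)) , λ p → ⊥-elim (¬p p))
                  (∁-mem (gen (TopologicalSpace.U-open X)))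

  Borel-∪ : ∀ {A B} → Borel X A → Borel X B → Borel X (A ∪ B)
  Borel-∪ {A} {B} mA mB = resp-≐ (to , from) (⋃-mem C mC)
    where
    C : ℕ → Subset Carrier
    C zero    = A
    C (suc _) = B
    mC : ∀ n → Borel X (C n)
    mC zero    = mA
    mC (suc _) = mB
    to : ∀ {x} → ⋃ ℕ C x → (A ∪ B) x
    to (zero  , x∈A) = inj₁ x∈A
    to (suc _ , x∈B) = inj₂ x∈B
    from : ∀ {x} → (A ∪ B) x → ⋃ ℕ C x
    from (inj₁ x∈A) = 0 , x∈A
    from (inj₂ x∈B) = 1 , x∈B

  -- De Morgan; excluded middle removes the double negations.
  Borel-∩ : ∀ {A B} → Borel X A → Borel X B → Borel X (A ∩ B)
  Borel-∩ {A} {B} mA mB = resp-≐ (to , from) (∁-mem (Borel-∪ (∁-mem mA) (∁-mem mB)))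
    where
    to : ∀ {x} → ∁ (∁ A ∪ ∁ B) x → (A ∩ B) x
    to {x} ¬∪ = decidable-stable em (¬∪ ∘ inj₁) , decidable-stable em (¬∪ ∘ inj₂)
    from : ∀ {x} → (A ∩ B) x → ∁ (∁ A ∪ ∁ B) x
    from (x∈A , x∈B) (inj₁ x∉A) = x∉A x∈A
    from (x∈A , x∈B) (inj₂ x∉B) = x∉B x∈B

  -- Three nested countable unions take the place of an enumeration of the triples.
  Borel-⋃³ : (A : ℕ × ℕ × ℕ → Subset Carrier) → (∀ i → Borel X (A i)) →
             Borel X (⋃ (ℕ × ℕ × ℕ) A)
  Borel-⋃³ A mA = resp-≐
    ((λ (l , m , n , x∈A) → (l , m , n) , x∈A) , λ ((l , m , n) , x∈A) → l , m , n , x∈A)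
    (⋃-mem _ λ l → ⋃-mem _ λ m → ⋃-mem (λ n → A (l , m , n)) λ n → mA (l , m , n))

module _ (X Y : TopologicalSpace)
         (f : TopologicalSpace.Carrier X → TopologicalSpace.Carrier Y) where

  -- Preimages commute with complements and countable unions, so induction on the generation of the
  -- Borel set applies.
  measurable-fromOpen :
    (∀ {B} → TopologicalSpace.Open Y B → Borel X (f ⊢ B)) → Measurable X Y f
  measurable-fromOpen m (gen oB) = m oB
  measurable-fromOpen m (resp-≐ (A⊆B , B⊆A) mA) =
    resp-≐ ((λ x∈A → A⊆B x∈A) , λ x∈B → B⊆A x∈B) (measurable-fromOpen m mA)
  measurable-fromOpen m (∁-mem mA) = ∁-mem (measurable-fromOpen m mA)
  measurable-fromOpen m (⋃-mem A mA) =
    ⋃-mem (λ n → f ⊢ A n) λ n → measurable-fromOpen m (mA n)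

-- Open sets and division in the extended reals.

module _ (R : RealNumbers) where
  open RealNumbers R
  open OrderedField R
  open ExtendedReals R hiding (ℝₑ; _≈ₑ_; opₑ; negₑ; ℝₑ-space)

  -- Induction on how the open set is built: `err` contributes no real point, and an interval inside
  -- one member of a union lies inside the union.
  Openₑ-trace : ∀ {B} → Openₑ B → Openℝ (just ⊢ B)
  Openₑ-trace (open-real oA) (just x∈A) with a , b , a<x<b , ab⊆A ← oA x∈A =
    a , b , a<x<b , λ a<y y<b → just (ab⊆A a<y y<b)
  Openₑ-trace open-err ()
  Openₑ-trace (⋃-openₑ A oA) (i , x∈A) with a , b , a<x<b , ab⊆A ← Openₑ-trace (oA i) x∈A =
    a , b , a<x<b , λ a<y y<b → i , ab⊆A a<y y<b
  Openₑ-trace (resp-≐ₑ (A⊆B , B⊆A) oA) x∈B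
    with a , b , a<x<b , ab⊆A ← Openₑ-trace oA (B⊆A x∈B) =
    a , b , a<x<b , λ a<y y<b → A⊆B (ab⊆A a<y y<b)

  -- `Any` fails at `err`, so both rays contain real values only, while their complements contain
  -- `err`.
  Above Below : Carrier → Subset (ℝₑ R)
  Above a = Any (a <_)
  Below b = Any (_< b)

  Real : Subset (ℝₑ R)
  Real = Any U

  Above-open : ∀ a → Openₑ (Above a)
  Above-open a = open-real λ {x} a<x →
    -- Openness asks for a bounded interval; any right end beyond `x` would do.
    a , x + 1# , (a<x , x<x+ε x 0<1) , λ a<y _ → a<y

  quotient-zero : ∀ r {s} → s ≈ 0# → quotient r s ≡ nothing
  quotient-zero r {s} s≈0 with s ≟ 0#
  ... | yes _  = refl
  ... | no s≉0 = ⊥-elim (s≉0 s≈0)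

  -- The equation `t * s ≈ r` lets inequalities about the quotient be multiplied out by `s`.
  quotient-nonzero : ∀ r {s} → ¬ (s ≈ 0#) → ∃[ t ] (quotient r s ≡ just t × t * s ≈ r)
  quotient-nonzero r {s} s≉0 with s ≟ 0#
  ... | yes s≈0 = ⊥-elim (s≉0 s≈0)
  ... | no s≉0′ with w , sw≈1 ← inverse s s≉0′ =
    r * w , refl , x*[y*z]≈x r (≈-trans (*-comm w s) sw≈1)

-- Measurability through upper rays; negation and scaling.

module AboveMeasurability (em : ExcludedMiddle 0ℓ) (R : RealNumbers)
                          (X : TopologicalSpace) where
  open RealNumbers R
  open OrderedField R
  open Density em R
  open BorelSets em X
  open ExtendedReals R using (Openₑ; quotient)

  X→ℝₑ : Set
  X→ℝₑ = TopologicalSpace.Carrier X → ℝₑ R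

  AboveMeasurable : X→ℝₑ → Set₁
  AboveMeasurable f = ∀ a → Borel X (f ⊢ Above R a)

  AboveMeasurable-cong : ∀ {f g} → (∀ x → _≈ₑ_ R (f x) (g x)) →
                         AboveMeasurable f → AboveMeasurable g
  AboveMeasurable-cong {f} {g} f≈g mf a = resp-≐
    ((λ {x} → to (f≈g x)) , λ {x} → from (f≈g x)) (mf a)
    where
    to : ∀ {r s} → _≈ₑ_ R r s → Above R a r → Above R a s
    to (just r≈s) (just a<r) = just (<-respʳ-≈ r≈s a<r)
    from : ∀ {r s} → _≈ₑ_ R r s → Above R a s → Above R a r
    from (just r≈s) (just a<s) = just (<-respʳ-≈ (sym r≈s) a<s)

  module _ {f : X→ℝₑ} (mf : AboveMeasurable f) where

    -- Every real lies above some grid point, so the real part of `f` is a countable union of ray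
    -- preimages. Its complement is where `f` is `err`.
    Borel-real : Borel X (f ⊢ Real R)
    Borel-real = resp-≐ ((λ {x} → to (f x)) , λ {x} → from (f x))
      (Borel-⋃³ (λ i → f ⊢ Above R (point i)) λ i → mf (point i))
      where
      to : ∀ r → ∃[ i ] Above R (point i) r → Real R r
      to _ (_ , just _) = just _
      from : ∀ r → Real R r → ∃[ i ] Above R (point i) r
      from (just r) (just _) with i , _ , p<r ← dense (x-1<x r) = i , just p<r

    -- A real value is below `b` exactly when it is at most some grid point `p < b`. Being at most
    -- `p` is the complement of a ray, cut down to real values to exclude `err`.
    Borel-below : ∀ b → Borel X (f ⊢ Below R b)
    Borel-below b = resp-≐ ((λ {x} → to (f x)) , λ {x} → from (f x))
      (Borel-⋃³ _ λ i → Borel-∩ (Borel-const (point i < b))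
        (Borel-∩ Borel-real (∁-mem (mf (point i)))))
      where
      to : ∀ r → ∃[ i ] (point i < b × Real R r × ¬ Above R (point i) r) → Below R b r
      to (just r) (i , p<b , just _ , p≮r) = just (begin-strict
        r        ≤⟨ ≮⇒≥ (p≮r ∘ just) ⟩
        point i  <⟨ p<b ⟩
        b        ∎)
      from : ∀ r → Below R b r → ∃[ i ] (point i < b × Real R r × ¬ Above R (point i) r)
      from (just r) (just r<b) with i , r<p , p<b ← dense r<b =
        i , p<b , just _ , λ { (just p<r) → <-asym r<p p<r }

    -- Around each real point of `B` there is an interval inside `B` with grid endpoints, so
    -- countably many intervals cover the real part. Which pairs of endpoints are admissible, and
    -- whether `err` belongs to `B`, are constant conditions.
    Borel-preimage : ∀ {B} → Openₑ B → Borel X (f ⊢ B)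
    Borel-preimage {B} oB = resp-≐ ((λ {x} → to (f x)) , λ {x} → from (f x))
      (Borel-∪
        (Borel-⋃³ _ λ i → Borel-⋃³ _ λ j → Borel-∩ (Borel-const (Inside i j))
          (Borel-∩ (mf (point i)) (Borel-below (point j))))
        (Borel-∩ (Borel-const (B err)) (∁-mem Borel-real)))
      where
      Inside : Index → Index → Set
      Inside i j = ∀ {y} → point i < y → y < point j → B (just y)
      Covered : Subset (ℝₑ R)
      Covered r =
        ∃[ i ] ∃[ j ] (Inside i j × Above R (point i) r × Below R (point j) r) ⊎
        B err × ¬ Real R r
      to : ∀ r → Covered r → B r
      to (just r) (inj₁ (_ , _ , ⊆B , just a<r , just r<b)) = ⊆B a<r r<b
      to (just r) (inj₂ (_ , notReal)) = ⊥-elim (notReal (just _))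
      to nothing  (inj₂ (err∈B , _)) = err∈B
      from : ∀ r → B r → Covered r
      from nothing  err∈B = inj₂ (err∈B , λ ())
      from (just r) r∈B
        with a , b , (a<r , r<b) , ab⊆B ← Openₑ-trace R oB r∈B
        with i , a<p , p<r ← dense a<r
        with j , r<q , q<b ← dense r<b =
        inj₁ (i , j , (λ p<y y<q → ab⊆B (<-trans a<p p<y) (<-trans y<q q<b)) ,
              just p<r , just r<q)

    AboveMeasurable⇒Measurable : Measurable X (ℝₑ-space R) f
    AboveMeasurable⇒Measurable = measurable-fromOpen X (ℝₑ-space R) f Borel-preimage

    AboveMeasurable-neg : AboveMeasurable (negₑ R ∘ f)
    AboveMeasurable-neg a = resp-≐ ((λ {x} → to (f x)) , λ {x} → from (f x))
      (Borel-below (- a))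
      where
      to : ∀ r → Below R (- a) r → Above R a (negₑ R r)
      to (just r) (just r<-a) = just (<-respˡ-≈ (-‿involutive a) (neg-anti-< r<-a))
      from : ∀ r → Above R a (negₑ R r) → Below R (- a) r
      from (just r) (just a<-r) = just (<-respˡ-≈ (-‿involutive r) (neg-anti-< a<-r))

    AboveMeasurable-scale-pos : ∀ {c} → 0# < c → AboveMeasurable (map (c *_) ∘ f)
    AboveMeasurable-scale-pos {c} 0<c a = resp-≐ ((λ {x} → to (f x)) , λ {x} → from (f x))
      (mf (a * w))
      where
      w : Carrier
      w = proj₁ (leftInverse 0<c)
      awc≈a : a * w * c ≈ a
      awc≈a = x*[y*z]≈x a (proj₂ (leftInverse 0<c))
      to : ∀ r → Above R (a * w) r → Above R a (map (c *_) r)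
      to (just r) (just aw<r) = just (begin-strict
        a          ≈⟨ awc≈a ⟨
        a * w * c  <⟨ *-monoˡ-<-pos 0<c aw<r ⟩
        r * c      ≈⟨ *-comm r c ⟩
        c * r      ∎)
      from : ∀ r → Above R a (map (c *_) r) → Above R (a * w) r
      from (just r) (just a<cr) = just (*-cancelʳ-<-pos 0<c (begin-strict
        a * w * c  ≈⟨ awc≈a ⟩
        a          <⟨ a<cr ⟩
        c * r      ≈⟨ *-comm c r ⟩
        r * c      ∎))

    -- The scaled function is zero wherever `f` is real, so the preimage is the whole real part or
    -- empty, according to whether `a < 0#`.
    AboveMeasurable-scale-zero : ∀ {c} → c ≈ 0# → AboveMeasurable (map (c *_) ∘ f)
    AboveMeasurable-scale-zero {c} c≈0 a = resp-≐ ((λ {x} → to (f x)) , λ {x} → from (f x))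
      (Borel-∩ (Borel-const (a < 0#)) Borel-real)
      where
      cr≈0 : ∀ r → c * r ≈ 0#
      cr≈0 r = ≈-trans (*-congʳ c≈0) (zeroˡ r)
      to : ∀ r → a < 0# × Real R r → Above R a (map (c *_) r)
      to (just r) (a<0 , _) = just (<-respʳ-≈ (sym (cr≈0 r)) a<0)
      from : ∀ r → Above R a (map (c *_) r) → a < 0# × Real R r
      from (just r) (just a<cr) = <-respʳ-≈ (cr≈0 r) a<cr , just _

  -- All signs of `c` occur, since products scale by grid points and quotients by the threshold `a`.
  -- A negative `c` is traded for `- c` acting on the negated function.
  AboveMeasurable-scale : ∀ c {f} → AboveMeasurable f → AboveMeasurable (map (c *_) ∘ f)
  AboveMeasurable-scale c {f} mf with <-compare c 0#
  ... | tri≈ _ c≈0 _ = AboveMeasurable-scale-zero mf c≈0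
  ... | tri> _ _ 0<c = AboveMeasurable-scale-pos mf 0<c
  ... | tri< c<0 _ _ = AboveMeasurable-cong (λ x → [-c][-r]≈cr (f x))
    (AboveMeasurable-scale-pos (AboveMeasurable-neg mf) (x<0⇒0<-x c<0))
    where
    [-c][-r]≈cr : ∀ r → _≈ₑ_ R (map (- c *_) (negₑ R r)) (map (c *_) r)
    [-c][-r]≈cr nothing  = nothing
    [-c][-r]≈cr (just r) = just (-x*-y≈x*y c r)

  -- Sums, differences, products and quotients.

  AboveMeasurable-plus : ∀ {f g} → AboveMeasurable f → AboveMeasurable g →
                         AboveMeasurable (λ x → opₑ R plus (f x) (g x))
  AboveMeasurable-plus {f} {g} mf mg a = resp-≐
    ((λ {x} → to (f x) (g x)) , λ {x} → from (f x) (g x))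
    (Borel-⋃³ _ λ i → Borel-∩ (mf (point i)) (mg (a + - point i)))
    where
    to : ∀ r s → ∃[ i ] (Above R (point i) r × Above R (a + - point i) s) →
         Above R a (opₑ R plus r s)
    to (just r) (just s) (i , just p<r , just a-p<s) = just (begin-strict
      a            <⟨ x-z<y⇒x<y+z a-p<s ⟩
      s + point i  <⟨ +-monoʳ-< s p<r ⟩
      s + r        ≈⟨ +-comm s r ⟩
      r + s        ∎)
    from : ∀ r s → Above R a (opₑ R plus r s) →
           ∃[ i ] (Above R (point i) r × Above R (a + - point i) s)
    from (just r) (just s) (just a<r+s)
      -- A grid point `p` between `a - s` and `r` also satisfies `a - p < s`.
      with i , a-s<p , p<r ← dense (x<y+z⇒x-z<y a<r+s) =
      i , just p<r , just (x<y+z⇒x-z<y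
        (<-respʳ-≈ (+-comm (point i) s) (x-z<y⇒x<y+z a-s<p)))

  AboveMeasurable-minus : ∀ {f g} → AboveMeasurable f → AboveMeasurable g →
                          AboveMeasurable (λ x → opₑ R minus (f x) (g x))
  AboveMeasurable-minus {f} {g} mf mg = AboveMeasurable-cong (λ x → r+[-s]≈r-s (f x) (g x))
    (AboveMeasurable-plus mf (AboveMeasurable-neg mg))
    where
    r+[-s]≈r-s : ∀ r s → _≈ₑ_ R (opₑ R plus r (negₑ R s)) (opₑ R minus r s)
    r+[-s]≈r-s nothing  _        = nothing
    r+[-s]≈r-s (just _) nothing  = nothing
    r+[-s]≈r-s (just _) (just _) = just ≈-refl

  Borel-times-pos : ∀ {f g} → AboveMeasurable f → AboveMeasurable g → ∀ a →
    Borel X ((g ⊢ Above R 0#) ∩ ((λ x → opₑ R times (f x) (g x)) ⊢ Above R a))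
  Borel-times-pos {f} {g} mf mg a = resp-≐
    ((λ {x} → to (f x) (g x)) , λ {x} → from (f x) (g x))
    (Borel-⋃³ _ λ i → Borel-∩ (mf (point i))
      (Borel-∩ (mg 0#) (AboveMeasurable-scale (point i) mg a)))
    where
    to : ∀ r s →
      ∃[ i ] (Above R (point i) r × Above R 0# s × Above R a (map (point i *_) s)) →
      Above R 0# s × Above R a (opₑ R times r s)
    to (just r) (just s) (i , just p<r , just 0<s , just a<ps) =
      just 0<s , just (<-trans a<ps (*-monoˡ-<-pos 0<s p<r))
    from : ∀ r s → Above R 0# s × Above R a (opₑ R times r s) →
      ∃[ i ] (Above R (point i) r × Above R 0# s × Above R a (map (point i *_) s))
    from (just r) (just s) (just 0<s , just a<rs)
      -- With `w` the inverse of `s`, the inequality becomes `a * w < r`. A grid point in between,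
      -- multiplied back by `s`, still exceeds `a`.
      with w , ws≈1 ← leftInverse 0<s
      with i , aw<p , p<r ← dense (*-cancelʳ-<-pos 0<s
                              (<-respˡ-≈ (sym (x*[y*z]≈x a ws≈1)) a<rs)) =
      i , just p<r , just 0<s ,
      just (<-respˡ-≈ (x*[y*z]≈x a ws≈1) (*-monoˡ-<-pos 0<s aw<p))

  -- Split by the sign of `g`. Where `g` is negative, the product equals that of the negated
  -- functions, which is the positive case again. Where `g` is real and in neither ray at zero, the
  -- product is zero and the condition reads `a < 0#`.
  AboveMeasurable-times : ∀ {f g} → AboveMeasurable f → AboveMeasurable g →
                          AboveMeasurable (λ x → opₑ R times (f x) (g x))
  AboveMeasurable-times {f} {g} mf mg a = resp-≐
    ((λ {x} → to (f x) (g x)) , λ {x} → from (f x) (g x))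
    (Borel-∪ (Borel-times-pos mf mg a)
      (Borel-∪ (Borel-times-pos (AboveMeasurable-neg mf) (AboveMeasurable-neg mg) a)
        (Borel-∩ (Borel-∩ (Borel-real mf) (Borel-real mg))
          (Borel-∩ (Borel-const (a < 0#))
            (Borel-∩ (∁-mem (mg 0#)) (∁-mem (Borel-below mg 0#)))))))
    where
    Pieces : ℝₑ R → ℝₑ R → Set
    Pieces r s =
      (Above R 0# s × Above R a (opₑ R times r s)) ⊎
      (Above R 0# (negₑ R s) × Above R a (opₑ R times (negₑ R r) (negₑ R s))) ⊎
      (Real R r × Real R s) × a < 0# × ¬ Above R 0# s × ¬ Below R 0# s
    to : ∀ r s → Pieces r s → Above R a (opₑ R times r s)
    to r s (inj₁ (_ , a<rs)) = a<rs
    to (just r) (just s) (inj₂ (inj₁ (_ , just a<rs))) =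
      just (<-respʳ-≈ (-x*-y≈x*y r s) a<rs)
    to (just r) (just s) (inj₂ (inj₂ (_ , a<0 , 0≮s , s≮0))) with <-compare s 0#
    ... | tri< s<0 _ _ = ⊥-elim (s≮0 (just s<0))
    ... | tri≈ _ s≈0 _ = just (<-respʳ-≈ (sym (≈-trans (*-congˡ s≈0) (zeroʳ r))) a<0)
    ... | tri> _ _ 0<s = ⊥-elim (0≮s (just 0<s))
    from : ∀ r s → Above R a (opₑ R times r s) → Pieces r s
    from (just r) (just s) (just a<rs) with <-compare s 0#
    ... | tri< s<0 _ _ = inj₂ (inj₁ (just (x<0⇒0<-x s<0) ,
      just (<-respʳ-≈ (sym (-x*-y≈x*y r s)) a<rs)))
    ... | tri≈ s≮0 s≈0 0≮s = inj₂ (inj₂ ((just _ , just _) ,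
      <-respʳ-≈ (≈-trans (*-congˡ s≈0) (zeroʳ r)) a<rs ,
      (λ { (just 0<s) → 0≮s 0<s }) , λ { (just s<0) → s≮0 s<0 }))
    ... | tri> _ _ 0<s = inj₁ (just 0<s , just a<rs)

  -- Multiplying by `g` preserves or reverses the inequality according to its sign, leaving a
  -- comparison of `f - a g` with zero. Where `g` is zero the quotient is `err` and lies in no ray.
  AboveMeasurable-divide : ∀ {f g} → AboveMeasurable f → AboveMeasurable g →
                           AboveMeasurable (λ x → opₑ R divide (f x) (g x))
  AboveMeasurable-divide {f} {g} mf mg a = resp-≐
    ((λ {x} → to (f x) (g x)) , λ {x} → from (f x) (g x))
    (Borel-∪ (Borel-∩ (mg 0#) (mf-ag 0#))
             (Borel-∩ (Borel-below mg 0#) (Borel-below mf-ag 0#)))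
    where
    r-as : ℝₑ R → ℝₑ R → ℝₑ R
    r-as r s = opₑ R minus r (map (a *_) s)
    mf-ag : AboveMeasurable (λ x → r-as (f x) (g x))
    mf-ag = AboveMeasurable-minus mf (AboveMeasurable-scale a mg)
    Pieces : ℝₑ R → ℝₑ R → Set
    Pieces r s = (Above R 0# s × Above R 0# (r-as r s)) ⊎
                 (Below R 0# s × Below R 0# (r-as r s))
    to : ∀ r s → Pieces r s → Above R a (opₑ R divide r s)
    to (just r) (just s) (inj₁ (just 0<s , just 0<r-as))
      with t , r/s≡t , ts≈r ← quotient-nonzero R r {s} (proj₂ 0<s ∘ sym) =
      subst (Above R a) (≡-sym r/s≡t) (just (*-cancelʳ-<-pos 0<s
        (<-respʳ-≈ (sym ts≈r) (0<y-x⇒x<y 0<r-as))))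
    to (just r) (just s) (inj₂ (just s<0 , just r-as<0))
      with t , r/s≡t , ts≈r ← quotient-nonzero R r {s} (proj₂ s<0) =
      subst (Above R a) (≡-sym r/s≡t) (just (*-cancelʳ-<-neg s<0
        (<-respˡ-≈ (sym ts≈r) (y-x<0⇒y<x r-as<0))))
    from : ∀ r s → Above R a (opₑ R divide r s) → Pieces r s
    from (just r) (just s) a<r/s with <-compare s 0#
    ... | tri≈ _ s≈0 _ with () ← subst (Above R a) (quotient-zero R r s≈0) a<r/s
    ... | tri> _ s≉0 0<s
      with t , r/s≡t , ts≈r ← quotient-nonzero R r s≉0
      with just a<t ← subst (Above R a) r/s≡t a<r/s =
      inj₁ (just 0<s , just (x<y⇒0<y-x (<-respʳ-≈ ts≈r (*-monoˡ-<-pos 0<s a<t))))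
    ... | tri< s<0 s≉0 _
      with t , r/s≡t , ts≈r ← quotient-nonzero R r s≉0
      with just a<t ← subst (Above R a) r/s≡t a<r/s =
      inj₂ (just s<0 , just (y<x⇒y-x<0 (<-respˡ-≈ ts≈r (*-monoˡ-<-neg s<0 a<t))))

  AboveMeasurable-op : ∀ ⋄ {f g} → AboveMeasurable f → AboveMeasurable g →
                       AboveMeasurable (λ x → opₑ R ⋄ (f x) (g x))
  AboveMeasurable-op plus   = AboveMeasurable-plus
  AboveMeasurable-op minus  = AboveMeasurable-minus
  AboveMeasurable-op times  = AboveMeasurable-times
  AboveMeasurable-op divide = AboveMeasurable-divide

-- Measurability of the real semantics.

module RealSemantics (em : ExcludedMiddle 0ℓ) (R : RealNumbers) (V : Set) where
  open AboveMeasurability em R (powerSpace (ℝₑ-space R) V)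
  open BorelSets em (powerSpace (ℝₑ-space R) V) using (Borel-const)

  AboveMeasurable-⟦⟧ᵣ : ∀ e → AboveMeasurable (⟦_⟧ᵣ R e)
  AboveMeasurable-⟦⟧ᵣ (const q) a = Borel-const _
  -- A variable is a coordinate projection, so its ray preimages are open cylinders.
  AboveMeasurable-⟦⟧ᵣ (var x) a = gen (gen (cylinder x (Above-open R a)))
  AboveMeasurable-⟦⟧ᵣ (neg e) = AboveMeasurable-neg (AboveMeasurable-⟦⟧ᵣ e)
  AboveMeasurable-⟦⟧ᵣ (bin ⋄ e₁ e₂) =
    AboveMeasurable-op ⋄ (AboveMeasurable-⟦⟧ᵣ e₁) (AboveMeasurable-⟦⟧ᵣ e₂)

-- Continuity of the floating-point semantics.

module FloatSemantics {R : RealNumbers} (F : FloatingPoint R) (V : Set) where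
  open FloatingPoint F using (𝔽ₑ; proj; inj)
  open TopologicalSpace (powerSpace (𝔽ₑ-space F) V) using (Open)

  continuous-⟦⟧f : ∀ e (B : Subset 𝔽ₑ) → Open (⟦_⟧f F e ⊢ B)
  continuous-⟦⟧f (const q) B = resp-≐
    ((λ (c∈B , _) → c∈B) , λ c∈B → c∈B , _)
    -- The union of copies of `U` indexed by the proofs that the constant lies in `B` is everything
    -- or empty, as required, without deciding which.
    (⋃-open {I = B (proj (just (RealNumbers.fromℚ R q)))} (λ _ → U) λ _ → U-open)
  continuous-⟦⟧f (var x) B = gen (cylinder x {B} _)
  continuous-⟦⟧f (neg e) B = continuous-⟦⟧f e ((proj ∘ negₑ R ∘ inj) ⊢ B)
  continuous-⟦⟧f (bin ⋄ e₁ e₂) B = resp-≐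
    ((λ { ((_ , ab∈B) , refl , refl) → ab∈B }) , λ ρ∈B → (_ , ρ∈B) , refl , refl)
    -- The index runs over the pairs of values whose rounded result lies in `B`; each pair
    -- contributes the intersection of the two fibres over its entries, open by induction.
    (⋃-open {I = Σ[ (a , b) ∈ 𝔽ₑ × 𝔽ₑ ] B (proj (opₑ R ⋄ (inj a) (inj b)))}
      (λ ((a , b) , _) → (⟦_⟧f F e₁ ⊢ (_≡ a)) ∩ (⟦_⟧f F e₂ ⊢ (_≡ b)))
      λ ((a , b) , _) → ∩-open (continuous-⟦⟧f e₁ (_≡ a)) (continuous-⟦⟧f e₂ (_≡ b)))

proposition1 : ExcludedMiddle 0ℓ →
    (V : Set) → V ↣ ℕ →
    (R : RealNumbers) (F : FloatingPoint R) →
    ((e : Expr V) →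
    Measurable (powerSpace (ℝₑ-space R) V) (ℝₑ-space R) (⟦_⟧ᵣ R e))
    ×
    (Finite V ⊎ Measurable (ℝₑ-space R) (𝔽ₑ-space F) (FloatingPoint.proj F) →
    (e : Expr V) →
    Measurable (powerSpace (𝔽ₑ-space F) V) (𝔽ₑ-space F) (⟦_⟧f F e))
proposition1 em V _ R F =
  (λ e → AboveMeasurable⇒Measurable (AboveMeasurable-⟦⟧ᵣ e)) ,
  λ _ e → measurable-fromOpen (powerSpace (𝔽ₑ-space F) V) (𝔽ₑ-space F) (⟦_⟧f F e)
    λ {B} _ → gen (continuous-⟦⟧f e B)
  where
  open AboveMeasurability em R (powerSpace (ℝₑ-space R) V)
  open RealSemantics em R V
  open FloatSemantics F V
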